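{- For every $n$, and every composition $I$ of $n$, the coefficient of $Y^I$ in the free Bell polynomial ${\bm B}_n$ is the sum of all $\mathbf G_{\hat\pi^\flat}$, where $\pi$ ranges over the set partitions of $[n]=\{1,\ldots,n\}$ such that $K(\pi)=I$. That is, $${\bm B}_n=\sum_{\pi\vdash[n]}Y^{K(\pi)}\,\mathbf G_{\hat\pi^\flat},$$ the sum being over all set partitions $\pi$ of $[n]$.
   Context: Let $\mathbb K$ be the ground field (characteristic $0$). FQSym. Let $A$ be a countably infinite totally ordered alphabet. The standardization $\mathrm{Std}(w)$ of a word $w$ of length $n$ is the unique permutation in $\mathfrak S_n$ (written as a word) with the same inversions as $w$. $\mathbf{FQSym}$ is the algebra spanned by $\mathbf G_\sigma=\sum_{w\in A^n,\ \mathrm{Std}(w)=\sigma}w$, for $\sigma\in\mathfrak S_n$, $n\ge 0$. For nonempty permutations $\alpha\in\mathfrak S_k$, $\beta\in\mathfrak S_l$ put $$\mathbf G_\alpha\prec\mathbf G_\beta=\sum_{\gamma}\mathbf G_\gamma,$$ where $\gamma$ ranges over the permutations in $\mathfrak S_{k+l}$ of the form $\gamma=uv$ with $|u|=k$, $\mathrm{Std}(u)=\alpha$, $\mathrm{Std}(v)=\beta$ and $\max(v)<\max(u)$; extend bilinearly. Let $S_n=\mathbf G_{12\cdots n}$. Free Bell polynomials. Let $Y_1,Y_2,\ldots$ be noncommuting indeterminates, and $Y^I=Y_{i_1}\cdots Y_{i_r}$ for a composition $I=(i_1,\ldots,i_r)$. Define ${\bm B}_n\in\mathbb K\langle Y_1,Y_2,\ldots\rangle\otimes\mathbf{FQSym}$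 by ${\bm B}_0=1$ and ${\bm B}_{n+1}=\sum_{k=0}^n Y_{k+1}S_{k+1}\prec{\bm B}_{n-k}$, where $\prec$ multiplies the $Y$-parts by concatenation and the $\mathbf{FQSym}$-parts by $\prec$ (and $S_{n+1}\prec 1$ is understood as $S_{n+1}$). Set partitions. For a set partition $\pi$ of $[n]$, let $\pi^\flat$ be the sequence of its blocks ordered so that their maximal elements decrease. $K(\pi)$ is the composition of $n$ recording the sizes of the blocks of $\pi^\flat$ in this order. $\hat\pi^\flat\in\mathfrak S_n$ is the permutation obtained by reading the blocks in this order, each block being read in increasing order. For example, for $\pi=347|28|1|56$ one has $\hat\pi^\flat=28347561$ and $K(\pi)=(2,3,2,1)$. -}

module Defs where

open import Algebra.Apartness.Bundles using (HeytingCommutativeRing; HeytingField)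
open import Algebra.Bundles using (CommutativeRing)
import Algebra.Definitions.RawMonoid as RawMonoidDefinitions
open import Data.Bool.Base using (if_then_else_)
open import Data.Fin.Base as Fin using (Fin; toℕ)
import Data.Fin.Properties as Fin
open import Data.Fin.Subset using (Subset; inside; outside; _∈_; _∩_; ∣_∣; Nonempty; Empty)
open import Data.Fin.Subset.Properties using (_∈?_; nonempty?; x∈p⇒∣p-x∣<∣p∣; x∈p∩q⁺)
open import Data.List.Base
  using (List; []; _∷_; _++_; map; mapMaybe; concatMap; filter; foldr; length; lookup; take; drop;
         allFin; cartesianProductWith)
open import Data.List.Extrema.Nat using (max)
open import Data.List.Membership.Propositional using () renaming (_∈_ to _∈ˡ_)
open import Data.List.Membership.Propositional.Properties
  using (∈-filter⁺; ∈-filter⁻; ∈-allFin; ∈-concat⁺′; ∈-map⁺)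
open import Data.List.Membership.Propositional.Properties.WithK using (unique∧set⇒bag)
import Data.List.Properties as List
open import Data.List.Relation.Binary.BagAndSetEquality using (∼bag⇒↭)
open import Data.List.Relation.Binary.Permutation.Propositional using (_↭_; ↭-sym; ↭⇒↭ₛ)
open import Data.List.Relation.Binary.Permutation.Propositional.Properties using (↭-length; Any-resp-↭)
import Data.List.Relation.Binary.Permutation.Setoid.Properties as Permutationₛ
open import Data.List.Relation.Unary.All as All using ()
open import Data.List.Relation.Unary.Any using (Any; any?)
open import Data.List.Relation.Unary.AllPairs as AllPairs using (AllPairs; allPairs?)
import Data.List.Relation.Unary.AllPairs.Properties as AllPairs
import Data.List.Relation.Unary.All.Properties as All
open import Data.List.Relation.Unary.Unique.Propositional using (Unique)
open import Data.List.Relation.Unary.Unique.Propositional.Properties using (allFin⁺; filter⁺; concat⁺)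
open import Data.List.Relation.Unary.Unique.DecPropositional using (unique?)
import Data.List.Sort as Sort
import Data.Maybe.Base as Maybe
open import Data.Nat.Base using (ℕ; zero; suc; _+_; _∸_; _<_; NonZero; >-nonZero; z≤n)
open import Data.Nat.ListAction using (sum)
import Data.Nat.Properties as ℕ
open import Data.Product.Base using (Σ; Σ-syntax; ∃; _×_; _,_; proj₁; proj₂; uncurry)
open import Data.Vec.Base as Vec using (Vec)
open import Function.Base using (_∘_)
open import Function.Bundles using (Inverse; _⇔_; mk⇔; Equivalence)
open import Level using (Level; _⊔_; 0ℓ) renaming (suc to lsuc)
open import Relation.Binary.Bundles using (StrictTotalOrder; DecTotalOrder)
import Relation.Binary.Construct.Flip.EqAndOrd as Flip
import Relation.Binary.Construct.On as On
open import Relation.Binary.Definitions using (DecidableEquality)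
open import Relation.Binary.PropositionalEquality using (_≡_; refl; sym; trans; cong; setoid)
open import Relation.Nullary.Decidable using (Dec; yes; no; does; map′; dec⇒maybe; ¬?; _×-dec_; _→-dec_)
open import Relation.Nullary.Negation using (¬_)
open import Relation.Unary using (Pred; Decidable)

private
  variable
    a b c p ℓ₁ ℓ₂ ℓ₃ ℓ₄ : Level
    A : Set a
    k l n : ℕ

select : {P : Pred A p} → Decidable P → List A → List (Σ A P)
select P? = mapMaybe (λ x → Maybe.map (x ,_) (dec⇒maybe (P? x)))

CharacteristicZero : HeytingField c ℓ₁ ℓ₂ → Set ℓ₁
CharacteristicZero 𝕂 = ∀ n → ¬ (suc n ×ᴷ 1# ≈ 0#)
  where
  open HeytingField 𝕂 using (heytingCommutativeRing)
  open CommutativeRing (HeytingCommutativeRing.commutativeRing heytingCommutativeRing)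
    using (_≈_; 0#; 1#; +-rawMonoid)
  open RawMonoidDefinitions +-rawMonoid using () renaming (_×_ to _×ᴷ_)

record Alphabet a ℓ₁ ℓ₂ : Set (lsuc (a ⊔ ℓ₁ ⊔ ℓ₂)) where
  field
    order             : StrictTotalOrder a ℓ₁ ℓ₂
    countablyInfinite : Inverse (StrictTotalOrder.Eq.setoid order) (setoid ℕ)

------------------------------------------------------------------------
-- Compositions

record ℕ⁺ : Set where
  constructor _⁺
  field
    value        : ℕ
    .{{nonZero}} : NonZero value

open ℕ⁺ public

_≟⁺_ : DecidableEquality ℕ⁺
(m ⁺) ≟⁺ (n ⁺) = map′ (λ { refl → refl }) (cong value) (m ℕ.≟ n)

Composition : Set
Composition = List ℕ⁺

_≟ᶜ_ : DecidableEquality Composition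
_≟ᶜ_ = List.≡-dec _≟⁺_

weight : Composition → ℕ
weight I = sum (map value I)

------------------------------------------------------------------------
-- Permutations as words. The letters are those of Fin n, i.e. 0, …, n - 1
-- instead of 1, …, n.

IsPermutation : List (Fin n) → Set
IsPermutation {n} w = length w ≡ n × Unique w

Perm : ℕ → Set
Perm n = Σ (List (Fin n)) IsPermutation

words : ∀ n (k : ℕ) → List (List (Fin n))
words n zero    = [] ∷ []
words n (suc k) = cartesianProductWith _∷_ (allFin n) (words n k)

permutations : ∀ n → List (Perm n)
permutations n = select (λ w → (length w ℕ.≟ n) ×-dec unique? Fin._≟_ w) (words n n)

identity : ∀ n → Perm n
identity n = allFin n , List.length-tabulate _ , allFin⁺ n

------------------------------------------------------------------------
-- Standardization

module _ (O : StrictTotalOrder a ℓ₁ ℓ₂) (O′ : StrictTotalOrder b ℓ₃ ℓ₄) where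
  private
    module O = StrictTotalOrder O
    module O′ = StrictTotalOrder O′

  SameInversions : List O.Carrier → List O′.Carrier → Set (ℓ₂ ⊔ ℓ₄)
  SameInversions u v = Σ[ eq ∈ length u ≡ length v ] (∀ i j → i Fin.< j →
    (lookup u j O.< lookup u i) ⇔ (lookup v (Fin.cast eq j) O′.< lookup v (Fin.cast eq i)))

  sameInversions? : ∀ u v → Dec (SameInversions u v)
  sameInversions? u v with length u ℕ.≟ length v
  ... | no neq = no (neq ∘ proj₁)
  ... | yes eq = map′ (eq ,_) proj₂ (Fin.all? λ i → Fin.all? λ j →
    (i Fin.<? j) →-dec
      ((lookup u j O.<? lookup u i) ⇔-dec (lookup v (Fin.cast eq j) O′.<? lookup v (Fin.cast eq i))))
    where
    _⇔-dec_ : ∀ {x y} {X : Set x} {Y : Set y} → Dec X → Dec Y → Dec (X ⇔ Y)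
    x? ⇔-dec y? = map′ (uncurry mk⇔) (λ e → Equivalence.to e , Equivalence.from e)
      ((x? →-dec y?) ×-dec (y? →-dec x?))

-- Std(w) = σ, for words w over the totally ordered set O.
module _ (O : StrictTotalOrder a ℓ₁ ℓ₂) where

  IsStd : List (StrictTotalOrder.Carrier O) → Perm n → Set ℓ₂
  IsStd {n} w (σ , _) = SameInversions O (Fin.<-strictTotalOrder n) w σ

  isStd? : ∀ w (σ : Perm n) → Dec (IsStd w σ)
  isStd? {n} w (σ , _) = sameInversions? O (Fin.<-strictTotalOrder n) w σ

------------------------------------------------------------------------
-- The half-product on basis elements

-- Used for nonempty words only; the default value 0 is then irrelevant.
maxLetter : List (Fin n) → ℕ
maxLetter w = max 0 (map toℕ w)

InHalfProduct : Perm (suc k) → Perm (suc l) → Perm (suc k + suc l) → Set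
InHalfProduct {k} {l} α β (γ , _) =
    IsStd (Fin.<-strictTotalOrder _) u α
  × IsStd (Fin.<-strictTotalOrder _) v β
  × maxLetter v < maxLetter u
  where
  u = take (suc k) γ
  v = drop (suc k) γ

inHalfProduct? : (α : Perm (suc k)) (β : Perm (suc l)) → Decidable (InHalfProduct α β)
inHalfProduct? {k} α β (γ , _) =
        isStd? (Fin.<-strictTotalOrder _) (take (suc k) γ) α
  ×-dec isStd? (Fin.<-strictTotalOrder _) (drop (suc k) γ) β
  ×-dec (maxLetter (drop (suc k) γ) ℕ.<? maxLetter (take (suc k) γ))

-- The permutations γ with G_α ≺ G_β = Σ_γ G_γ. The left factor is nonempty;
-- for an empty right factor, G_ε = 1 and G_α ≺ 1 = G_α.
_≺ᴳ_ : Perm (suc k) → Perm l → List (∃ Perm)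
_≺ᴳ_ {l = zero}  α β = (_ , α) ∷ []
_≺ᴳ_ {l = suc l} α β = map (_ ,_) (filter (inHalfProduct? α β) (permutations _))

------------------------------------------------------------------------
-- Set partitions of [n] = Fin n

Block : ℕ → Set
Block n = Σ (Subset n) Nonempty

IsSetPartition : List (Block n) → Set
IsSetPartition {n} bs =
    AllPairs (λ (p , _) (q , _) → Empty (p ∩ q)) bs
  × (∀ i → Any (λ (p , _) → i ∈ p) bs)

isSetPartition? : Decidable (IsSetPartition {n})
isSetPartition? bs =
        allPairs? (λ (p , _) (q , _) → ¬? (nonempty? (p ∩ q))) bs
  ×-dec Fin.all? (λ i → any? (λ (p , _) → i ∈? p) bs)

-- The order in which the blocks are listed carries no meaning.
SetPartition : ℕ → Set
SetPartition n = Σ (List (Block n)) IsSetPartition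

subsets : ∀ n → List (Subset n)
subsets zero    = Vec.[] ∷ []
subsets (suc n) = map (outside Vec.∷_) (subsets n) ++ map (inside Vec.∷_) (subsets n)

blocks : ∀ n → List (Block n)
blocks n = select nonempty? (subsets n)

sublists : List A → List (List A)
sublists []       = [] ∷ []
sublists (x ∷ xs) = sublists xs ++ map (x ∷_) (sublists xs)

-- Each set of blocks occurs exactly once among the sublists of blocks n,
-- hence each set partition exactly once below.
setPartitions : ∀ n → List (SetPartition n)
setPartitions n = select isSetPartition? (sublists (blocks n))

-- The elements of a block in increasing order.
elements : Block n → List (Fin n)
elements {n} (p , _) = filter (_∈? p) (allFin n)

blockSize : Block n → ℕ⁺
blockSize (p , x , x∈p) = (∣ p ∣ ⁺) {{>-nonZero (ℕ.≤-<-trans z≤n (x∈p⇒∣p-x∣<∣p∣ x∈p))}}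

decreasingMaxima : ℕ → DecTotalOrder 0ℓ 0ℓ 0ℓ
decreasingMaxima n =
  On.decTotalOrder (Flip.decTotalOrder ℕ.≤-decTotalOrder) (maxLetter ∘ elements {n})

_♭ : SetPartition n → List (Block n)
_♭ {n} (bs , _) = Sort.sort (decreasingMaxima n) bs

K : SetPartition n → Composition
K π = map blockSize (π ♭)

readingWord : SetPartition n → List (Fin n)
readingWord π = concatMap elements (π ♭)

readingWord-isPermutation : (π : SetPartition n) → IsPermutation (readingWord π)
readingWord-isPermutation {n} π@(bs , disjoint , covering) =
  trans (↭-length word↭allFin) (List.length-tabulate _) , unique
  where
  sort↭ : π ♭ ↭ bs
  sort↭ = Sort.sort-↭ (decreasingMaxima n) bs

  disjoint′ : AllPairs (λ (p , _) (q , _) → Empty (p ∩ q)) (π ♭)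
  disjoint′ = Permutationₛ.AllPairs-resp-↭ (setoid (Block n))
    (λ e (i , i∈) → e (i , ∩-swap i∈))
    ((λ { refl r → r }) , (λ { refl r → r }))
    (↭⇒↭ₛ (↭-sym sort↭)) disjoint
    where
    open import Data.Fin.Subset.Properties using (x∈p∩q⁻)
    ∩-swap : ∀ {i} {p q : Subset n} → i ∈ p ∩ q → i ∈ q ∩ p
    ∩-swap {p = p} {q} i∈ = let (i∈p , i∈q) = x∈p∩q⁻ p q i∈ in x∈p∩q⁺ (i∈q , i∈p)

  unique : Unique (readingWord π)
  unique = concat⁺
    (All.map⁺ (All.universal (λ (p , _) → filter⁺ (_∈? p) (allFin⁺ n)) (π ♭)))
    (AllPairs.map⁺ (AllPairs.map
      (λ { {p , _} {q , _} e (x∈ , y∈) → e (_ , x∈p∩q⁺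
             ( proj₂ (∈-filter⁻ (_∈? p) {xs = allFin n} x∈)
             , proj₂ (∈-filter⁻ (_∈? q) {xs = allFin n} y∈))) })
      disjoint′))

  complete : ∀ i → i ∈ˡ readingWord π
  complete i with find (Any-resp-↭ (↭-sym sort↭) (covering i))
    where open import Data.List.Membership.Propositional using (find)
  ... | B , B∈ , i∈B =
    ∈-concat⁺′ (∈-filter⁺ (_∈? proj₁ B) (∈-allFin i) i∈B) (∈-map⁺ elements B∈)

  word↭allFin : readingWord π ↭ allFin n
  word↭allFin = ∼bag⇒↭ (unique∧set⇒bag unique (allFin⁺ n)
    (mk⇔ (λ _ → ∈-allFin _) (λ _ → complete _)))

hat : SetPartition n → Perm n
hat π = readingWord π , readingWord-isPermutation π

------------------------------------------------------------------------
-- FQSym and free Bell polynomials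

module FreeBell (𝕂 : HeytingField c ℓ₁ ℓ₂) (𝔸 : Alphabet a ℓ₃ ℓ₄) where
  open HeytingField 𝕂 using (_≈_; 0#; 1#)
    renaming (Carrier to Scalar; _+_ to _+ᴷ_; _*_ to _*ᴷ_)
  open Alphabet 𝔸 using (order)
  open StrictTotalOrder order using () renaming (Carrier to Letter)

  -- Finite formal linear combinations; addition is concatenation.
  Lin : Set b → Set (c ⊔ b)
  Lin X = List (Scalar × X)

  ∑ : {X : Set b} → List A → (A → Lin X) → Lin X
  ∑ xs f = concatMap f xs

  -- Noncommutative power series over the alphabet.
  Series : Set (c ⊔ a)
  Series = List Letter → Scalar

  𝐆-series : Perm n → Series
  𝐆-series σ w = if does (isStd? order w σ) then 1# else 0#

  -- An element of FQSym is given by its expansion on the 𝐆_σ, and equality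
  -- is equality of the resulting series. The 𝐆_σ being linearly independent,
  -- operations may be defined through these expansions.
  FQSym : Set c
  FQSym = Lin (∃ Perm)

  𝐆 : Perm n → FQSym
  𝐆 σ = (1# , (_ , σ)) ∷ []

  series : FQSym → Series
  series x w = foldr (λ (s , (_ , σ)) r → (s *ᴷ 𝐆-series σ w) +ᴷ r) 0# x

  infix 4 _≈ᶠ_ _≈ᵗ_
  _≈ᶠ_ : FQSym → FQSym → Set (ℓ₁ ⊔ a)
  x ≈ᶠ y = ∀ w → series x w ≈ series y w

  -- 𝕂⟨Y₁,Y₂,…⟩ ⊗ FQSym, on the basis Y^I ⊗ 𝐆_σ.
  Tensor : Set c
  Tensor = Lin (Composition × ∃ Perm)

  -- The same with the nonempty permutations only.
  Tensor⁺ : Set c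
  Tensor⁺ = Lin (Composition × ∃ (Perm ∘ suc))

  coefficient : Composition → Tensor → FQSym
  coefficient I t = map (λ (s , (_ , σ)) → s , σ) (filter (λ (_ , (J , _)) → J ≟ᶜ I) t)

  _≈ᵗ_ : Tensor → Tensor → Set (ℓ₁ ⊔ a)
  t ≈ᵗ t′ = ∀ I → coefficient I t ≈ᶠ coefficient I t′

  infixr 7 Y^_⊗_
  Y^_⊗_ : Composition → FQSym → Tensor
  Y^ I ⊗ x = map (λ (s , σ) → s , (I , σ)) x

  infixr 6 _≺_
  _≺_ : Tensor⁺ → Tensor → Tensor
  t ≺ t′ = ∑ t λ (r , (I , (_ , α))) → ∑ t′ λ (s , (J , (_ , β))) →
    map (λ γ → r *ᴷ s , (I ++ J , γ)) (α ≺ᴳ β)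

  one : Tensor
  one = Y^ [] ⊗ 𝐆 (identity 0)

  -- YS k is Y_{k+1} S_{k+1}.
  YS : ℕ → Tensor⁺
  YS k = (1# , ((suc k ⁺) ∷ [] , (k , identity (suc k)))) ∷ []

  -- Bs n = B_n ∷ B_{n-1} ∷ … ∷ B_0
  Bs : ∀ n → Vec Tensor (suc n)
  Bs zero    = one Vec.∷ Vec.[]
  Bs (suc n) = ∑ (allFin (suc n)) (λ k → YS (toℕ k) ≺ Vec.lookup (Bs n) k) Vec.∷ Bs n

  B : ℕ → Tensor
  B n = Vec.head (Bs n)

  B-zero : B 0 ≡ one
  B-zero = refl

  B-suc : ∀ n → B (suc n) ≡ ∑ (allFin (suc n)) (λ k → YS (toℕ k) ≺ B (n ∸ toℕ k))
  B-suc n = List.concatMap-cong (λ k → cong (YS (toℕ k) ≺_) (lookup-Bs n k)) (allFin (suc n))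
    where
    lookup-Bs : ∀ n (k : Fin (suc n)) → Vec.lookup (Bs n) k ≡ B (n ∸ toℕ k)
    lookup-Bs zero    Fin.zero    = refl
    lookup-Bs (suc n) Fin.zero    = refl
    lookup-Bs (suc n) (Fin.suc k) = lookup-Bs n k

{-# OPTIONS --safe #-}
module Submission where

-- Call a word flat for a composition I if, cut into factors of lengths I, its factors are
-- increasing and each of them contains, for every later letter, a larger one. The right-hand
-- side runs over the permutations flat for I, once each: a set partition is recovered by
-- cutting. So does B_n, by induction: the first factor of a flat permutation has standardization
-- S_{k+1} and dominates the rest, and the rest is flat exactly when its standardization is,
-- since flatness only depends on the relative order of the letters.

open import Defs
open import Algebra.Apartness.Bundles using (HeytingCommutativeRing; HeytingField)
open import Algebra.Bundles using (CommutativeRing)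
open import Data.Bool.Base using (true; false; if_then_else_)
import Data.Bool.Properties as Bool
open import Data.Empty using (⊥)
open import Data.Fin.Base as Fin using (Fin; toℕ; fromℕ<)
import Data.Fin.Properties as Fin
open import Data.Fin.Subset as Subset using (Subset; _∩_; ∣_∣; Empty)
import Data.Fin.Subset.Properties as Subset
open import Data.List.Base hiding (find)
open import Data.List.Extrema.Nat using (xs≤max; argmax-sel)
open import Data.List.Membership.DecPropositional using (_∈?_)
open import Data.List.Membership.Propositional using (_∈_; _∉_; find; lose)
open import Data.List.Membership.Propositional.Properties
open import Data.List.Membership.Propositional.Properties.WithK using (unique∧set⇒bag)
open import Data.List.Properties
open import Data.List.Relation.Binary.BagAndSetEquality using (∼bag⇒↭)
open import Data.List.Relation.Binary.Permutation.Propositional as ↭ using (_↭_; ↭-sym; ↭⇒↭ₛ)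
open import Data.List.Relation.Binary.Permutation.Propositional.Properties
  using (∈-resp-↭) renaming (map⁺ to ↭-map⁺)
import Data.List.Relation.Binary.Permutation.Setoid.Properties as Permutationₛ
open import Data.List.Relation.Unary.All as All using (All; []; _∷_)
import Data.List.Relation.Unary.All.Properties as All
open import Data.List.Relation.Unary.AllPairs as AllPairs using (AllPairs; []; _∷_)
import Data.List.Relation.Unary.AllPairs.Properties as AllPairs
open import Data.List.Relation.Unary.Any as Any using (Any; here; there)
import Data.List.Relation.Unary.Any.Properties as Any
open import Data.List.Relation.Unary.Linked.Properties using (Linked⇒AllPairs)
open import Data.List.Relation.Unary.Unique.DecPropositional using (unique?)
open import Data.List.Relation.Unary.Unique.Propositional using (Unique)
import Data.List.Relation.Unary.Unique.Propositional.Properties as Unique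
import Data.List.Sort as Sort
open import Data.Nat.Base as ℕ using (ℕ; zero; suc; _+_; _∸_; z≤n; s≤s)
open import Data.Nat.Induction using (<-rec)
import Data.Nat.Properties as ℕ
open import Data.Product.Base using (∃; ∃-syntax; _×_; _,_; proj₁; proj₂)
open import Data.Sum.Base using (inj₁; inj₂)
import Data.Vec.Base as Vec
import Data.Vec.Properties as Vec
open import Function.Base using (_∘_; id)
open import Function.Bundles using (_⇔_; mk⇔; Equivalence)
open import Level using (Level; _⊔_)
open import Relation.Binary.Bundles using (StrictTotalOrder)
open import Relation.Binary.Core using (Rel)
open import Relation.Binary.Definitions using (Asymmetric; tri<; tri≈; tri>)
open import Relation.Binary.PropositionalEquality hiding ([_])
open import Relation.Nullary.Decidable using (yes; no; does; _×-dec_; dec-true)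
open import Relation.Nullary.Negation using (¬_; contradiction)
open import Relation.Unary using (Pred; Decidable)

-- A permutation carries a proof that its letters are distinct, and a block carries an element
-- witnessing that it is nonempty. Neither is determined by the word or the subset, so the terms of
-- the two sides cannot be matched by plain equality. Each side is instead shown to list every pair
-- of a composition and a permutation flat for it exactly once, with scalar `1#`. Once the proofs
-- are forgotten, two repetition-free lists with the same members remain; they are rearrangements of
-- each other, and no cancellation has to be considered. Blocks are likewise compared through their
-- underlying subsets.

private
  variable
    a b p r : Level
    A : Set a
    X : Set b
    k l m n : ℕ

-- Lists: selections, concatenations and sorted lists

map-proj₁-select : {P : Pred A p} (P? : Decidable P) (xs : List A) →
                   map proj₁ (select P? xs) ≡ filter P? xs
map-proj₁-select P? []       = refl
map-proj₁-select P? (x ∷ xs) with P? x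
... | yes _ = cong (x ∷_) (map-proj₁-select P? xs)
... | no  _ = map-proj₁-select P? xs

∈-select⁺ : {P : Pred A p} (P? : Decidable P) {x : A} {xs : List A} → x ∈ xs → P x →
            ∃[ px ] (x , px) ∈ select P? xs
∈-select⁺ P? {x} {xs} x∈ px
  with ∈-map⁻ proj₁ (subst (x ∈_) (sym (map-proj₁-select P? xs)) (∈-filter⁺ P? x∈ px))
... | (_ , qx) , q∈ , refl = qx , q∈

allPairs-select : {R : Rel A r} {P : Pred A p} (P? : Decidable P) {xs : List A} →
                  AllPairs R xs → AllPairs (λ x y → R (proj₁ x) (proj₁ y)) (select P? xs)
allPairs-select P? {xs} Rxs =
  AllPairs.map⁻ (subst (AllPairs _) (sym (map-proj₁-select P? xs)) (AllPairs.filter⁺ P? Rxs))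

∈-concatMap⁻′ : (f : A → List X) (xs : List A) {y : X} → y ∈ concatMap f xs →
                ∃[ x ] x ∈ xs × y ∈ f x
∈-concatMap⁻′ f xs = find ∘ ∈-concatMap⁻ f

∈-concatMap⁺′ : (f : A → List X) {xs : List A} {x : A} {y : X} → x ∈ xs → y ∈ f x →
                y ∈ concatMap f xs
∈-concatMap⁺′ f x∈ y∈ = ∈-concatMap⁺ f (lose x∈ y∈)

allPairs-concatMap : {S : Rel A p} {R : Rel X r} (f : A → List X) {xs : List A} →
  AllPairs S xs → (∀ {x} → x ∈ xs → AllPairs R (f x)) →
  (∀ {x y a b} → S x y → a ∈ f x → b ∈ f y → R a b) →
  AllPairs R (concatMap f xs)
allPairs-concatMap f Sxs within across = AllPairs.concat⁺
  (All.map⁺ (All.tabulate within))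
  (AllPairs.map⁺ (AllPairs.map
    (λ s → All.tabulate λ a∈ → All.tabulate λ b∈ → across s a∈ b∈) Sxs))

-- Were the heads different, each would lie in the tail of the other list, giving both `R x y` and
-- `R y x`.
head-unique : {R : Rel A r} → Asymmetric R → ∀ {x y xs ys} → AllPairs R (x ∷ xs) → AllPairs R (y ∷ ys) →
              x ∈ y ∷ ys → y ∈ x ∷ xs → x ≡ y
head-unique asym _ _ (here eq) _ = eq
head-unique asym _ _ (there _) (here eq) = sym eq
head-unique asym (Rx ∷ _) (Ry ∷ _) (there x∈) (there y∈) =
  contradiction (All.lookup Ry x∈) (asym (All.lookup Rx y∈))

-- Used with `<` on letters, to recover an increasing word from its set of letters, and with `≻` on
-- subsets, to recover the order of the blocks.
sorted-unique : {R : Rel A r} → Asymmetric R → ∀ {xs ys} → AllPairs R xs → AllPairs R ys →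
                (∀ {x} → x ∈ xs → x ∈ ys) → (∀ {x} → x ∈ ys → x ∈ xs) → xs ≡ ys
sorted-unique asym {[]}     {[]}     _ _ _ _ = refl
sorted-unique asym {[]}     {y ∷ ys} _ _ _ from with from (here refl)
... | ()
sorted-unique asym {x ∷ xs} {[]}     _ _ to _ with to (here refl)
... | ()
sorted-unique asym {x ∷ xs} {y ∷ ys} Rxs@(Rx ∷ Rxs′) Rys@(Ry ∷ Rys′) to from
  with head-unique asym Rxs Rys (to (here refl)) (from (here refl))
... | refl = cong (x ∷_) (sorted-unique asym Rxs′ Rys′
    (λ z∈ → shrink Rx z∈ (to (there z∈))) (λ z∈ → shrink Ry z∈ (from (there z∈))))
  where
  shrink : ∀ {zs ws z} → All _ zs → z ∈ zs → z ∈ x ∷ ws → z ∈ ws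
  shrink R z∈ (here refl) = let q = All.lookup R z∈ in contradiction q (asym q)
  shrink _ _  (there z∈)  = z∈

filter-filter : ∀ {q} {P : Pred A p} {Q : Pred A q} (P? : Decidable P) (Q? : Decidable Q) →
                (∀ {x} → P x → Q x) → ∀ xs → filter P? (filter Q? xs) ≡ filter P? xs
filter-filter P? Q? P⊆Q [] = refl
filter-filter P? Q? P⊆Q (x ∷ xs) with Q? x
... | no ¬q = trans (filter-filter P? Q? P⊆Q xs) (sym (filter-reject P? (¬q ∘ P⊆Q)))
... | yes _ with does (P? x)
...   | true  = cong (x ∷_) (filter-filter P? Q? P⊆Q xs)
...   | false = filter-filter P? Q? P⊆Q xs

lookup-injective : {xs : List A} → Unique xs → ∀ {i j} → lookup xs i ≡ lookup xs j → i ≡ j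
lookup-injective {xs = _ ∷ _} _        {Fin.zero}  {Fin.zero}  _  = refl
lookup-injective {xs = _ ∷ _} (px ∷ _) {Fin.zero}  {Fin.suc j} eq = contradiction eq (All.lookup px (∈-lookup j))
lookup-injective {xs = _ ∷ _} (px ∷ _) {Fin.suc i} {Fin.zero}  eq = contradiction (sym eq) (All.lookup px (∈-lookup i))
lookup-injective {xs = _ ∷ _} (_ ∷ u)  {Fin.suc i} {Fin.suc j} eq = cong Fin.suc (lookup-injective u eq)

cast-injective : (eq : m ≡ n) → ∀ {i j} → Fin.cast eq i ≡ Fin.cast eq j → i ≡ j
cast-injective eq {i} {j} e = Fin.toℕ-injective
  (trans (sym (Fin.toℕ-cast eq i)) (trans (cong toℕ e) (Fin.toℕ-cast eq j)))

-- Permutations as words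

map-lookup-cast : ∀ {n} (xs : List A) (eq : n ≡ length xs) →
                  map (lookup xs ∘ Fin.cast eq) (allFin n) ≡ xs
map-lookup-cast xs refl = trans
  (map-tabulate id (lookup xs ∘ Fin.cast refl))
  (trans (tabulate-cong (λ i → cong (lookup xs) (Fin.cast-is-id refl i))) (tabulate-lookup xs))

-- Pigeonhole: with a missing letter put in front, `w` would give `suc n` distinct letters of
-- `Fin n`.
permutation-complete : {w : List (Fin n)} → IsPermutation w → ∀ i → i ∈ w
permutation-complete {n} {w} (len , uniq) i with _∈?_ Fin._≟_ i w
... | yes i∈ = i∈
... | no  i∉ = contradiction (Fin.injective⇒≤ (lookup-injective {xs = i ∷ w} (All.¬Any⇒All¬ w i∉ ∷ uniq)))
                 (ℕ.<⇒≱ (s≤s (ℕ.≤-reflexive (sym len))))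

∈-words : (w : List (Fin n)) → length w ≡ k → w ∈ words n k
∈-words []      refl = here refl
∈-words (x ∷ w) refl = ∈-cartesianProductWith⁺ _∷_ (∈-allFin x) (∈-words w refl)

words-unique : ∀ n k → Unique (words n k)
words-unique n zero    = [] ∷ []
words-unique n (suc k) = Unique.cartesianProductWith⁺ _∷_ ∷-injective (Unique.allFin⁺ n) (words-unique n k)

isPermutation? : Decidable (IsPermutation {n})
isPermutation? {n} w = (length w ℕ.≟ n) ×-dec unique? Fin._≟_ w

∈-permutations : {w : List (Fin n)} → IsPermutation w → ∃[ q ] (w , q) ∈ permutations n
∈-permutations q@(len , _) = ∈-select⁺ isPermutation? (∈-words _ len) q

permutations-distinct : ∀ n → AllPairs (λ σ τ → proj₁ σ ≢ proj₁ τ) (permutations n)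
permutations-distinct n = allPairs-select isPermutation? (words-unique n n)

-- Order isomorphisms

-- Words are treated as labellings of a common set of positions, so that the subwords `map f z` and
-- `map g z` at the same positions can be compared.
_≅_ : (A → Fin m) → (A → Fin n) → Set _
f ≅ g = ∀ x y → (f x Fin.< f y) ⇔ (g x Fin.< g y)

≅-sym : {f : A → Fin m} {g : A → Fin n} → f ≅ g → g ≅ f
≅-sym e x y = mk⇔ (Equivalence.from (e x y)) (Equivalence.to (e x y))

<-recover : {i j : Fin m} → i ≢ j → ¬ (j Fin.< i) → i Fin.< j
<-recover {i = i} {j} i≢j j≮i with Fin.<-cmp i j
... | tri< i<j _ _ = i<j
... | tri≈ _ i≡j _ = contradiction i≡j i≢j
... | tri> _ _ j<i = contradiction j<i j≮i

≅-trans : {f : A → Fin l} {g : A → Fin m} {h : A → Fin n} → f ≅ g → g ≅ h → f ≅ h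
≅-trans e e′ x y = mk⇔ (Equivalence.to (e′ x y) ∘ Equivalence.to (e x y))
                       (Equivalence.from (e x y) ∘ Equivalence.from (e′ x y))

-- Inversions only tell when a later letter is smaller. As letters do not repeat, a pair that is no
-- inversion is strictly increasing, so every comparison is determined.
sameInversions⇒≅ : {u : List (Fin m)} {v : List (Fin n)} → Unique u → Unique v →
  SameInversions (Fin.<-strictTotalOrder m) (Fin.<-strictTotalOrder n) u v →
  ∃[ g ] lookup u ≅ g × map g (allFin (length u)) ≡ v
sameInversions⇒≅ {u = u} {v} u! v! (eq , inv) = lookup v ∘ Fin.cast eq , iso , map-lookup-cast v eq
  where
  iso : lookup u ≅ (lookup v ∘ Fin.cast eq)
  iso i j with Fin.<-cmp i j
  ... | tri≈ _ refl _ = mk⇔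
    (λ q → contradiction q (Fin.<-irrefl refl)) (λ q → contradiction q (Fin.<-irrefl refl))
  ... | tri> _ _ j<i  = inv j i j<i
  ... | tri< i<j i≢j _ = mk⇔
    (λ q → <-recover (i≢j ∘ cast-injective eq ∘ lookup-injective v!)
                     (Fin.<-asym q ∘ Equivalence.from (inv i j i<j)))
    (λ q → <-recover (i≢j ∘ lookup-injective u!)
                     (Fin.<-asym q ∘ Equivalence.to (inv i j i<j)))

-- Standardization

module _ {f : A → Fin n} {g : A → Fin m} (iso : f ≅ g) (f-surj : ∀ y → ∃[ x ] f x ≡ y) where

  -- Induction on the value of `f x`: by surjectivity the preceding value is some `f z`, and `g z`
  -- lies strictly below `g x`.
  surjective-≅⇒≤ : ∀ k x → toℕ (f x) ≡ k → k ℕ.≤ toℕ (g x)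
  surjective-≅⇒≤ zero    x eq = z≤n
  surjective-≅⇒≤ (suc k) x eq
    with f-surj (fromℕ< (ℕ.<-trans (ℕ.≤-reflexive (sym eq)) (Fin.toℕ<n (f x))))
  ... | z , fz≡ = ℕ.≤-<-trans (surjective-≅⇒≤ k z fz≡k)
    (Equivalence.to (iso z x) (ℕ.≤-reflexive (trans (cong suc fz≡k) (sym eq))))
    where fz≡k = trans (cong toℕ fz≡) (Fin.toℕ-fromℕ< _)

surjective-≅⇒≗ : {f g : A → Fin n} → f ≅ g → (∀ y → ∃[ x ] f x ≡ y) → (∀ y → ∃[ x ] g x ≡ y) → f ≗ g
surjective-≅⇒≗ iso f-surj g-surj x = Fin.≤-antisym
  (surjective-≅⇒≤ iso f-surj _ x refl) (surjective-≅⇒≤ (≅-sym iso) g-surj _ x refl)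

-- Through `v` the two candidates are order isomorphic labellings. Both are surjective, being
-- permutations, and a surjective labelling is pinned down by its order.
standardization-unique : {v : List (Fin m)} → Unique v → (β β′ : Perm l) →
  IsStd (Fin.<-strictTotalOrder m) v β → IsStd (Fin.<-strictTotalOrder m) v β′ → proj₁ β ≡ proj₁ β′
standardization-unique v! (β , pβ) (β′ , pβ′) s s′
  with sameInversions⇒≅ v! (proj₂ pβ) s | sameInversions⇒≅ v! (proj₂ pβ′) s′
... | g , f≅g , eq | h , f≅h , eq′ = begin
  β                   ≡⟨ eq ⟨
  map g (allFin _)    ≡⟨ map-cong g≗h (allFin _) ⟩
  map h (allFin _)    ≡⟨ eq′ ⟩
  β′                  ∎
  where
  open ≡-Reasoning
  surj : {w : List (Fin n)} {f : Fin k → Fin n} → IsPermutation w → map f (allFin k) ≡ w →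
         ∀ y → ∃[ x ] f x ≡ y
  surj {f = f} pw refl y with ∈-map⁻ f (permutation-complete pw y)
  ... | x , _ , y≡ = x , sym y≡

  g≗h : g ≗ h
  g≗h = surjective-≅⇒≗ (≅-trans (≅-sym f≅g) f≅h) (surj pβ eq) (surj pβ′ eq′)

module Rank {f : Fin l → Fin m} (f-inj : ∀ {i j} → f i ≡ f j → i ≡ j) where

  private
    below : Fin l → List (Fin l)
    below i = filter (λ j → f j Fin.<? f i) (allFin l)

  length-below<l : ∀ i → length (below i) ℕ.< l
  length-below<l i = subst (length (below i) ℕ.<_) (length-tabulate id)
    (filter-notAll (λ j → f j Fin.<? f i) (allFin l) (lose (∈-allFin i) (Fin.<-irrefl refl)))

  -- The number of positions with a smaller label. The position `i` is never counted for itself,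
  -- which keeps the count below `l`.
  rank : Fin l → Fin l
  rank i = fromℕ< (length-below<l i)

  rank-mono : ∀ {i j} → f i Fin.< f j → rank i Fin.< rank j
  -- The positions below `i` are obtained by filtering those below `j`, and this filtering loses at
  -- least `i` itself.
  rank-mono {i} {j} i<j = subst₂ ℕ._<_ (sym (Fin.toℕ-fromℕ< _)) (sym (Fin.toℕ-fromℕ< _))
    (subst (ℕ._< length (below j))
      (cong length (filter-filter (λ x → f x Fin.<? f i) (λ x → f x Fin.<? f j)
        (λ x<i → Fin.<-trans x<i i<j) (allFin l)))
      (filter-notAll (λ x → f x Fin.<? f i) (below j)
        (lose (∈-filter⁺ (λ x → f x Fin.<? f j) (∈-allFin i) i<j) (Fin.<-irrefl refl))))

  rank-≅ : f ≅ rank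
  rank-≅ i j = mk⇔ rank-mono reflect
    where
    reflect : rank i Fin.< rank j → f i Fin.< f j
    reflect r with Fin.<-cmp (f i) (f j)
    ... | tri< i<j _ _ = i<j
    ... | tri≈ _ i≡j _ = contradiction r (Fin.<-irrefl (cong rank (f-inj i≡j)))
    ... | tri> _ _ j<i = contradiction r (Fin.<-asym (rank-mono j<i))

  rank-injective : ∀ {i j} → rank i ≡ rank j → i ≡ j
  rank-injective {i} {j} eq with Fin.<-cmp (f i) (f j)
  ... | tri< i<j _ _ = contradiction (rank-mono i<j) (Fin.<-irrefl eq)
  ... | tri≈ _ i≡j _ = f-inj i≡j
  ... | tri> _ _ j<i = contradiction (rank-mono j<i) (Fin.<-irrefl (sym eq))

standardization : {v : List (Fin m)} → Unique v → length v ≡ l →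
                  ∃[ β ] IsStd (Fin.<-strictTotalOrder m) {l} v β
standardization {v = v} v! refl =
  (tabulate rank , length-tabulate rank , Unique.tabulate⁺ rank-injective) ,
  sym (length-tabulate rank) ,
  λ i j _ → subst₂ (λ x y → (lookup v j Fin.< lookup v i) ⇔ (y Fin.< x))
    (lookup-rank i) (lookup-rank j) (rank-≅ j i)
  where
  open Rank (lookup-injective v!)
  lookup-rank : ∀ i → rank i ≡ lookup (tabulate rank) (Fin.cast (sym (length-tabulate rank)) i)
  lookup-rank i = sym (lookup-tabulate rank i)

map-lookup : (xs : List A) → map (lookup xs) (allFin (length xs)) ≡ xs
map-lookup xs = trans (map-tabulate id (lookup xs)) (tabulate-lookup xs)

allPairs-lookup : {R : Rel A r} {xs : List A} → AllPairs R xs →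
                  ∀ {i j} → i Fin.< j → R (lookup xs i) (lookup xs j)
allPairs-lookup (Rx ∷ _)  {Fin.zero}  {Fin.suc j} _         = All.lookup Rx (∈-lookup j)
allPairs-lookup (_ ∷ Rxs) {Fin.suc i} {Fin.suc j} (s≤s i<j) = allPairs-lookup Rxs i<j

-- Flat words

Increasing : List (Fin m) → Set
Increasing = AllPairs Fin._<_

-- Vacuous for an empty `v`, whereas `maxLetter v < maxLetter u` can then fail because of the
-- default `0`. It also refers to the order of the letters only, not to their values.
Dominates : List (Fin m) → List (Fin m) → Set
Dominates u v = All (λ y → Any (y Fin.<_) u) v

-- The length condition is explicit because `take` silently truncates; the clause for `[]` forces
-- the parts to use up the whole word.
IsFlat : Composition → List (Fin m) → Set
IsFlat []      w = w ≡ []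
IsFlat (i ∷ I) w =
    value i ℕ.≤ length w
  × Increasing (take (value i) w)
  × Dominates (take (value i) w) (drop (value i) w)
  × IsFlat I (drop (value i) w)

module _ {f : A → Fin m} {g : A → Fin n} (iso : f ≅ g) where

  increasing-≅ : ∀ z → Increasing (map f z) → Increasing (map g z)
  increasing-≅ z = AllPairs.map⁺ ∘ AllPairs.map (Equivalence.to (iso _ _)) ∘ AllPairs.map⁻

  dominates-≅ : ∀ z z′ → Dominates (map f z) (map f z′) → Dominates (map g z) (map g z′)
  dominates-≅ z z′ = All.map⁺ ∘ All.map (Any.map⁺ ∘ Any.map (Equivalence.to (iso _ _)) ∘ Any.map⁻) ∘ All.map⁻

  -- Stated for a list `z` of positions: `take` and `drop` then commute with `map`, and the same `f`
  -- and `g` serve for the remainder of the word.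
  isFlat-≅ : ∀ I z → IsFlat I (map f z) → IsFlat I (map g z)
  isFlat-≅ []      []      refl = refl
  isFlat-≅ (i ∷ I) z (len , inc , dom , flat)
    rewrite take-map {f = f} (value i) z | drop-map {f = f} (value i) z
          | take-map {f = g} (value i) z | drop-map {f = g} (value i) z =
    subst (value i ℕ.≤_) (trans (length-map f z) (sym (length-map g z))) len ,
    increasing-≅ (take (value i) z) inc ,
    dominates-≅ (take (value i) z) (drop (value i) z) dom ,
    isFlat-≅ I (drop (value i) z) flat

allFin-increasing : ∀ n → Increasing (allFin n)
allFin-increasing n = AllPairs.tabulate⁺-< id

module _ {v : List (Fin m)} (v! : Unique v) where

  isFlat-std : (β : Perm l) → IsStd (Fin.<-strictTotalOrder m) v β → ∀ I → IsFlat I v ⇔ IsFlat I (proj₁ β)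
  isFlat-std (β , _ , β!) s I with sameInversions⇒≅ v! β! s
  ... | g , iso , refl = mk⇔
    (isFlat-≅ iso I (allFin (length v)) ∘ subst (IsFlat I) (sym (map-lookup v)))
    (subst (IsFlat I) (map-lookup v) ∘ isFlat-≅ (≅-sym iso) I (allFin (length v)))

  isStd-identity⁻ : IsStd (Fin.<-strictTotalOrder m) v (identity l) → Increasing v
  isStd-identity⁻ {l = l} s with sameInversions⇒≅ v! (proj₂ (proj₂ (identity l))) s
  ... | g , iso , eq = subst Increasing (map-lookup v)
    (increasing-≅ (≅-sym iso) (allFin (length v)) (subst Increasing (sym eq) (allFin-increasing l)))

isStd-identity⁺ : {v : List (Fin m)} → Increasing v → length v ≡ l →
                  IsStd (Fin.<-strictTotalOrder m) v (identity l)
isStd-identity⁺ {l = l} inc refl = eq , λ i j i<j → mk⇔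
  (λ q → contradiction q (Fin.<-asym (allPairs-lookup inc i<j)))
  (λ q → contradiction q (Fin.<-asym (allPairs-lookup (allFin-increasing l) (cast-mono i<j))))
  where
  eq = sym (proj₁ (proj₂ (identity l)))
  cast-mono : ∀ {i j} → i Fin.< j → Fin.cast eq i Fin.< Fin.cast eq j
  cast-mono {i} {j} = subst₂ ℕ._<_ (sym (Fin.toℕ-cast eq i)) (sym (Fin.toℕ-cast eq j))

letter≤maxLetter : {w : List (Fin m)} → ∀ {x} → x ∈ w → toℕ x ℕ.≤ maxLetter w
letter≤maxLetter {w = w} x∈ = All.lookup (xs≤max 0 (map toℕ w)) (∈-map⁺ toℕ x∈)

maxLetter-attained : {w : List (Fin m)} → ∀ {x} → x ∈ w → ∃[ y ] y ∈ w × toℕ y ≡ maxLetter w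
maxLetter-attained {w = w} {x} x∈ with argmax-sel id 0 (map toℕ w)
-- The maximum may be the default `0`; the given letter is then at most `0` and attains it.
... | inj₁ max≡0 = x , x∈ , ℕ.≤-antisym (letter≤maxLetter x∈) (subst (ℕ._≤ toℕ x) (sym max≡0) z≤n)
... | inj₂ max∈ with ∈-map⁻ toℕ max∈
...   | y , y∈ , eq = y , y∈ , sym eq

maxLetter<⇒dominates : {u v : List (Fin m)} → ∀ {x} → x ∈ u → maxLetter v ℕ.< maxLetter u → Dominates u v
maxLetter<⇒dominates {u = u} x∈ v<u with maxLetter-attained x∈
... | z , z∈ , z≡ = All.tabulate λ {y} y∈ →
  lose z∈ (subst (toℕ y ℕ.<_) (sym z≡) (ℕ.≤-<-trans (letter≤maxLetter y∈) v<u))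

-- A letter of `u` exceeds the maximum of `v`, provided that this maximum is attained: hence the
-- letter `y` of `v`.
dominates⇒maxLetter< : {u v : List (Fin m)} → ∀ {y} → y ∈ v → Dominates u v → maxLetter v ℕ.< maxLetter u
dominates⇒maxLetter< {u = u} y∈ dom with maxLetter-attained y∈
... | z , z∈ , z≡ with find (All.lookup dom z∈)
...   | x , x∈ , z<x = subst (ℕ._< maxLetter u) z≡ (ℕ.<-≤-trans z<x (letter≤maxLetter x∈))

-- Half-products with an identity on the left

word : ∃ Perm → ∃[ m ] List (Fin m)
word (m , (σ , _)) = m , σ

nonempty : (w : List A) → length w ≡ suc k → ∃[ x ] x ∈ w
nonempty (x ∷ _) _ = x , here refl

length-take-≤ : ∀ {i} (w : List A) → i ℕ.≤ length w → length (take i w) ≡ i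
length-take-≤ {i = i} w i≤ = trans (length-take i w) (ℕ.m≤n⇒m⊓n≡m i≤)

-- Covers empty and nonempty right factors at once. The size is an equation because the half-product
-- with an empty factor lives in size `suc k`, not `suc k + 0`.
InIdentityHalfProduct : ∀ k → Perm l → List (Fin m) → Set
InIdentityHalfProduct {l = l} {m} k β w =
    m ≡ suc k + l
  × Increasing (take (suc k) w)
  × Dominates (take (suc k) w) (drop (suc k) w)
  × IsStd (Fin.<-strictTotalOrder m) (drop (suc k) w) β

∈-identity-≺ᴳ⁻ : ∀ k (β : Perm l) (γ : Perm m) → (m , γ) ∈ identity (suc k) ≺ᴳ β →
                 InIdentityHalfProduct k β (proj₁ γ)
∈-identity-≺ᴳ⁻ {l = zero} k ([] , _) _ (here refl)
  rewrite take-all (suc k) (allFin (suc k)) (ℕ.≤-reflexive (length-tabulate id))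
        | drop-all (suc k) (allFin (suc k)) (ℕ.≤-reflexive (length-tabulate id)) =
  sym (ℕ.+-identityʳ (suc k)) , allFin-increasing (suc k) , [] , refl , λ ()
∈-identity-≺ᴳ⁻ {l = suc l} k β (γ , len , γ!) γ∈ with ∈-map⁻ (_ ,_) γ∈
... | _ , γ∈′ , refl with ∈-filter⁻ (inHalfProduct? (identity (suc k)) β) {xs = permutations _} γ∈′
...   | _ , std-u , std-v , v<u =
  refl ,
  isStd-identity⁻ (Unique.take⁺ (suc k) γ!) std-u ,
  maxLetter<⇒dominates (proj₂ (nonempty (take (suc k) γ)
    (length-take-≤ γ (ℕ.≤-trans (ℕ.m≤m+n (suc k) (suc l)) (ℕ.≤-reflexive (sym len)))))) v<u ,
  std-v

∈-identity-≺ᴳ⁺ : ∀ k (β : Perm l) (γ : Perm m) → InIdentityHalfProduct k β (proj₁ γ) →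
                 ∃[ q ] (m , (proj₁ γ , q)) ∈ identity (suc k) ≺ᴳ β
∈-identity-≺ᴳ⁺ {l = zero} k β (γ , pγ@(len , _)) (eq , inc , _ , _) with trans eq (ℕ.+-identityʳ (suc k))
-- With an empty right factor the whole word is increasing, and an increasing permutation is the
-- identity.
... | refl with sorted-unique Fin.<-asym {xs = γ} {ys = allFin (suc k)}
                  (subst Increasing (take-all (suc k) γ (ℕ.≤-reflexive len)) inc)
                  (allFin-increasing (suc k)) (λ _ → ∈-allFin _) (λ _ → permutation-complete pγ _)
...   | refl = _ , here refl
∈-identity-≺ᴳ⁺ {l = suc l} k β (γ , pγ@(len , _)) (refl , inc , dom , std) with ∈-permutations pγ
... | q , γ∈ = q , ∈-map⁺ (_ ,_) (∈-filter⁺ (inHalfProduct? (identity (suc k)) β) γ∈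
  ( isStd-identity⁺ inc (length-take-≤ γ (ℕ.≤-trans (ℕ.m≤m+n (suc k) (suc l)) (ℕ.≤-reflexive (sym len))))
  , std
  , dominates⇒maxLetter< (proj₂ (nonempty (drop (suc k) γ)
      (trans (length-drop (suc k) γ) (trans (cong (_∸ suc k) len) (ℕ.m+n∸m≡n (suc k) (suc l)))))) dom))

identity-≺ᴳ-distinct : ∀ k (β : Perm l) → AllPairs (λ γ δ → word γ ≢ word δ) (identity (suc k) ≺ᴳ β)
identity-≺ᴳ-distinct {l = zero}  k β = [] ∷ []
identity-≺ᴳ-distinct {l = suc l} k β = AllPairs.map⁺ (AllPairs.map (λ { γ≢δ refl → γ≢δ refl })
  (AllPairs.filter⁺ (inHalfProduct? (identity (suc k)) β) (permutations-distinct _)))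

-- Cutting words and enumerating sublists

allPairs-mapWith : ∀ {q s} {P : Pred A q} {R : Rel A r} {S : Rel A s} {xs : List A} → All P xs →
  (∀ {x y} → P x → P y → R x y → S x y) → AllPairs R xs → AllPairs S xs
allPairs-mapWith []       f []         = []
allPairs-mapWith (p ∷ ps) f (Rx ∷ Rxs) =
  All.zipWith (λ (q , r) → f p q r) (ps , Rx) ∷ allPairs-mapWith ps f Rxs

take-++ : ∀ (xs ys : List A) → k ≡ length xs → take k (xs ++ ys) ≡ xs
take-++ []       ys refl = refl
take-++ (x ∷ xs) ys refl = cong (x ∷_) (take-++ xs ys refl)

drop-++ : ∀ (xs ys : List A) → k ≡ length xs → drop k (xs ++ ys) ≡ ys
drop-++ []       ys refl = refl
drop-++ (x ∷ xs) ys refl = drop-++ xs ys refl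

unique-++⁻ : (xs : List A) {ys : List A} → Unique (xs ++ ys) → Unique ys × (∀ {x} → x ∈ xs → x ∉ ys)
unique-++⁻ []       ys! = ys! , λ ()
unique-++⁻ (x ∷ xs) (x∉ ∷ u) with unique-++⁻ xs u
... | ys! , disj = ys! , λ { (here refl) x∈ys → All.lookup x∉ (∈-++⁺ʳ xs x∈ys) refl ; (there x∈) → disj x∈ }

sublist-∈ : {xs ys : List A} → ys ∈ sublists xs → ∀ {y} → y ∈ ys → y ∈ xs
sublist-∈ {xs = []}     (here refl) ()
sublist-∈ {xs = x ∷ xs} ys∈ y∈ with ∈-++⁻ (sublists xs) ys∈
... | inj₁ ys∈′ = there (sublist-∈ ys∈′ y∈)
... | inj₂ ys∈′ with ∈-map⁻ (x ∷_) ys∈′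
...   | zs , zs∈ , refl with y∈
...     | here y≡   = here y≡
...     | there y∈′ = there (sublist-∈ zs∈ y∈′)

filter-∈-sublists : {P : Pred A p} (P? : Decidable P) (xs : List A) → filter P? xs ∈ sublists xs
filter-∈-sublists P? []       = here refl
filter-∈-sublists P? (x ∷ xs) with does (P? x)
... | true  = ∈-++⁺ʳ (sublists xs) (∈-map⁺ (x ∷_) (filter-∈-sublists P? xs))
... | false = ∈-++⁺ˡ (filter-∈-sublists P? xs)

module _ (f : A → X) where

  SameImage : List A → List A → Set _
  SameImage xs ys = ∀ z → z ∈ map f xs ⇔ z ∈ map f ys

  private
    fresh : ∀ {x xs ys} → All (λ y → f x ≢ f y) xs → ys ∈ sublists xs → f x ∉ map f ys
    fresh x∉xs ys∈ fx∈ with ∈-map⁻ f fx∈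
    ... | y , y∈ , fx≡fy = All.lookup x∉xs (sublist-∈ ys∈ y∈) fx≡fy

    cancel : ∀ {x ys zs} → f x ∉ map f ys → SameImage (x ∷ ys) (x ∷ zs) →
             ∀ {z} → z ∈ map f ys → z ∈ map f zs
    cancel x∉ys e {z} z∈ with Equivalence.to (e z) (there z∈)
    ... | here refl = contradiction z∈ x∉ys
    ... | there z∈′ = z∈′

  -- The image of the head does not occur in the tail, so it separates the sublists with the head
  -- from those without; between two sublists with the head it cancels. Images are compared as sets
  -- because sorting will reorder the blocks.
  sublists-distinct : ∀ {xs} → AllPairs (λ x y → f x ≢ f y) xs →
                      AllPairs (λ ys zs → ¬ SameImage ys zs) (sublists xs)
  sublists-distinct []            = [] ∷ []
  sublists-distinct {x ∷ xs} (x∉xs ∷ xs!) = AllPairs.++⁺ (sublists-distinct xs!)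
    (AllPairs.map⁺ (allPairs-mapWith (All.tabulate id)
      (λ ys∈ zs∈ ys≢zs e → ys≢zs λ z → mk⇔
        (cancel (fresh x∉xs ys∈) e)
        (cancel (fresh x∉xs zs∈) (λ w → mk⇔ (Equivalence.from (e w)) (Equivalence.to (e w)))))
      (sublists-distinct xs!)))
    (All.tabulate λ {ys} ys∈ → All.map⁺ (All.tabulate λ {zs} zs∈ e →
      fresh x∉xs ys∈ (Equivalence.from (e (f x)) (here refl))))

-- Subsets and blocks

∈-subsets : (s : Subset n) → s ∈ subsets n
∈-subsets Vec.[]                    = here refl
∈-subsets (Subset.outside Vec.∷ s)  = ∈-++⁺ˡ (∈-map⁺ _ (∈-subsets s))
∈-subsets (Subset.inside Vec.∷ s)   = ∈-++⁺ʳ (map (Subset.outside Vec.∷_) (subsets _)) (∈-map⁺ _ (∈-subsets s))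

subsets-unique : ∀ n → Unique (subsets n)
subsets-unique zero    = [] ∷ []
subsets-unique (suc n) = Unique.++⁺
  (Unique.map⁺ Vec.∷-injectiveʳ (subsets-unique n)) (Unique.map⁺ Vec.∷-injectiveʳ (subsets-unique n))
  λ (s∈ , s∈′) → disjoint (∈-map⁻ (Subset.outside Vec.∷_) s∈) (∈-map⁻ (Subset.inside Vec.∷_) s∈′)
  where
  disjoint : ∀ {s} → ∃[ t ] t ∈ subsets n × s ≡ Subset.outside Vec.∷ t →
             ∃[ t ] t ∈ subsets n × s ≡ Subset.inside Vec.∷ t → ⊥
  disjoint (_ , _ , refl) (_ , _ , ())

blocks-distinct : ∀ n → AllPairs (λ B C → proj₁ B ≢ proj₁ C) (blocks n)
blocks-distinct n = allPairs-select Subset.nonempty? (subsets-unique n)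

module _ (C : Block n) where

  ∈-elements⁺ : ∀ {i} → i Subset.∈ proj₁ C → i ∈ elements C
  ∈-elements⁺ = ∈-filter⁺ (Subset._∈? proj₁ C) (∈-allFin _)

  ∈-elements⁻ : ∀ {i} → i ∈ elements C → i Subset.∈ proj₁ C
  ∈-elements⁻ = proj₂ ∘ ∈-filter⁻ (Subset._∈? proj₁ C) {xs = allFin n}

  elements-increasing : Increasing (elements C)
  elements-increasing = AllPairs.filter⁺ (Subset._∈? proj₁ C) (allFin-increasing n)

elements-injective : {C D : Block n} → elements C ≡ elements D → proj₁ C ≡ proj₁ D
elements-injective {C = C} {D} eq = Subset.⊆-antisym
  (λ {i} i∈ → ∈-elements⁻ D (subst (i ∈_) eq (∈-elements⁺ C i∈)))
  (λ {i} i∈ → ∈-elements⁻ C (subst (i ∈_) (sym eq) (∈-elements⁺ D i∈)))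

-- Stated for any `f` and `P` because the tail of `allFin` is tabulated by `Fin.suc`, which the
-- induction on the subset must absorb.
length-filter-tabulate : (s : Subset n) (f : Fin n → A) {P : Pred A p} (P? : Decidable P) →
  (∀ i → P (f i) ⇔ i Subset.∈ s) → length (filter P? (tabulate f)) ≡ ∣ s ∣
length-filter-tabulate Vec.[] f P? _ = refl
length-filter-tabulate (x Vec.∷ s) f P? P⇔∈ with P? (f Fin.zero) | x
  | length-filter-tabulate s (f ∘ Fin.suc) P? (λ i → mk⇔
      (Subset.drop-there ∘ Equivalence.to (P⇔∈ (Fin.suc i)))
      (Equivalence.from (P⇔∈ (Fin.suc i)) ∘ Vec.there))
  | P⇔∈ Fin.zero
... | yes _ | Subset.inside  | ih | _ = cong suc ih
... | no _  | Subset.outside | ih | _ = ih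
... | yes q | Subset.outside | _  | e with Equivalence.to e q
...   | ()
length-filter-tabulate (x Vec.∷ s) f P? P⇔∈ | no ¬q | Subset.inside | _ | e =
  contradiction (Equivalence.from e Vec.here) ¬q

length-elements : (C : Block n) → length (elements C) ≡ value (blockSize C)
length-elements C = length-filter-tabulate (proj₁ C) id (Subset._∈? proj₁ C) (λ _ → mk⇔ id id)

-- Flat words as readings of blocks with decreasing maxima

module _ {w : List (Fin n)} where

  letterSet : Subset n
  letterSet = Vec.tabulate (λ i → does (_∈?_ Fin._≟_ i w))

  ∈-letterSet⁻ : ∀ {i} → i Subset.∈ letterSet → i ∈ w
  ∈-letterSet⁻ {i} i∈ with _∈?_ Fin._≟_ i w
    | trans (sym (Vec.lookup∘tabulate (λ i → does (_∈?_ Fin._≟_ i w)) i)) (Vec.[]=⇒lookup i∈)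
  ... | yes i∈w | _  = i∈w
  ... | no _    | ()

  ∈-letterSet⁺ : ∀ {i} → i ∈ w → i Subset.∈ letterSet
  ∈-letterSet⁺ {i} i∈ = Vec.lookup⇒[]= i letterSet
    (trans (Vec.lookup∘tabulate (λ i → does (_∈?_ Fin._≟_ i w)) i) (dec-true (_∈?_ Fin._≟_ i w) i∈))

value-injective : {i j : ℕ⁺} → value i ≡ value j → i ≡ j
value-injective {_ ⁺} {_ ⁺} refl = refl

-- Defined on subsets rather than blocks, so that sorted lists of blocks can be compared after
-- forgetting their nonemptiness proofs.
_≻_ : Subset n → Subset n → Set
_≻_ {n} s t = letters t ℕ.< letters s
  where
  letters : Subset n → ℕ
  letters s = maxLetter (filter (Subset._∈? s) (allFin n))

MaximaDecrease : List (Block n) → Set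
MaximaDecrease = AllPairs (λ C D → proj₁ C ≻ proj₁ D)

maximaDecrease⇒isFlat : (bs : List (Block n)) → MaximaDecrease bs →
                        IsFlat (map blockSize bs) (concatMap elements bs)
maximaDecrease⇒isFlat []       _        = refl
maximaDecrease⇒isFlat (C@(_ , i , i∈) ∷ bs) (C≻ ∷ bs≻)
  rewrite take-++ (elements C) (concatMap elements bs) (sym (length-elements C))
        | drop-++ (elements C) (concatMap elements bs) (sym (length-elements C)) =
  ℕ.≤-trans (ℕ.≤-reflexive (sym (length-elements C)))
    (ℕ.≤-trans (ℕ.m≤m+n _ _) (ℕ.≤-reflexive (sym (length-++ (elements C))))) ,
  elements-increasing C ,
  All.concat⁺ (All.map⁺ (All.map (maxLetter<⇒dominates (∈-elements⁺ C i∈)) C≻)) ,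
  maximaDecrease⇒isFlat bs bs≻

-- The blocks are the sets of letters of the factors. An increasing factor is the increasing reading
-- of its set, so nothing is lost.
isFlat⇒maximaDecrease : ∀ I (w : List (Fin n)) → IsFlat I w →
  ∃[ bs ] map blockSize bs ≡ I × concatMap elements bs ≡ w × MaximaDecrease bs
isFlat⇒maximaDecrease []      .[] refl = [] , refl , refl , []
isFlat⇒maximaDecrease {n} (i ∷ I) w (i≤ , inc , dom , flat)
  with isFlat⇒maximaDecrease I (drop (value i) w) flat
... | bs , refl , eq , bs≻ =
  C ∷ bs ,
  cong (_∷ map blockSize bs) (value-injective (trans (sym (length-elements C)) (trans (cong length C≡u) len))) ,
  trans (cong₂ _++_ C≡u eq) (take++drop≡id (value i) w) ,
  All.tabulate (λ {D} → C≻ D) ∷ bs≻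
  where
  u = take (value i) w

  len : length u ≡ value i
  len = length-take-≤ w i≤

  -- Parts of a composition are nonzero, so the factor is a legitimate block.
  u-nonempty : ∃[ x ] x ∈ u
  u-nonempty = nonempty u (trans len (sym (ℕ.suc-pred (value i))))

  C : Block n
  C = letterSet {w = u} , proj₁ u-nonempty , ∈-letterSet⁺ (proj₂ u-nonempty)

  C≡u : elements C ≡ u
  C≡u = sorted-unique Fin.<-asym (elements-increasing C) inc
    (∈-letterSet⁻ ∘ ∈-elements⁻ C) (∈-elements⁺ C ∘ ∈-letterSet⁺)

  C≻ : ∀ D → D ∈ bs → proj₁ C ≻ proj₁ D
  C≻ D@(_ , j , j∈) D∈ rewrite C≡u = dominates⇒maxLetter< (∈-elements⁺ D j∈)
    (All.tabulate λ x∈ → All.lookup dom (subst (_ ∈_) eq (∈-concatMap⁺′ elements D∈ x∈)))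

-- The sizes tell where to cut the common word, and each piece determines its subset.
underlying-injective : (bs cs : List (Block n)) → map blockSize bs ≡ map blockSize cs →
  concatMap elements bs ≡ concatMap elements cs → map proj₁ bs ≡ map proj₁ cs
underlying-injective []       []       _  _  = refl
underlying-injective (C ∷ bs) (D ∷ cs) sz eq = cong₂ _∷_
  (elements-injective {C = C} {D} (trans (sym (take-++ (elements C) _ (sym (length-elements C))))
    (trans (cong (take (value (blockSize C))) eq) (take-++ (elements D) _ size≡))))
  (underlying-injective bs cs (∷-injectiveʳ sz) (trans (sym (drop-++ (elements C) _ (sym (length-elements C))))
    (trans (cong (drop (value (blockSize C))) eq) (drop-++ (elements D) _ size≡))))
  where
  size≡ : value (blockSize C) ≡ length (elements D)
  size≡ = trans (cong value (∷-injectiveˡ sz)) (sym (length-elements D))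

-- The nonemptiness proof enters `blockSize` only through an irrelevant field and `elements` not at
-- all.
underlying-cong : (bs cs : List (Block n)) → map proj₁ bs ≡ map proj₁ cs →
  map blockSize bs ≡ map blockSize cs × concatMap elements bs ≡ concatMap elements cs
underlying-cong []             []             _  = refl , refl
underlying-cong ((s , _) ∷ bs) ((t , _) ∷ cs) eq with ∷-injective eq
... | refl , eq′ with underlying-cong bs cs eq′
...   | sz , wd = cong₂ _∷_ refl sz , cong (_ ++_) wd

-- Set partitions

module _ (π : SetPartition n) where

  ♭-↭ : π ♭ ↭ proj₁ π
  ♭-↭ = Sort.sort-↭ (decreasingMaxima n) (proj₁ π)

  -- Sorting makes the maxima decrease weakly; equal maxima would be a letter common to two disjoint
  -- blocks.
  ♭-maximaDecrease : MaximaDecrease (π ♭)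
  ♭-maximaDecrease = AllPairs.zipWith (λ {C D} (D≤C , disj) → strict C D D≤C disj) (sorted , disjoint)
    where
    sorted : AllPairs (λ C D → maxLetter (elements D) ℕ.≤ maxLetter (elements C)) (π ♭)
    sorted = Linked⇒AllPairs (λ p q → ℕ.≤-trans q p) (Sort.sort-↗ (decreasingMaxima n) (proj₁ π))

    disjoint : AllPairs (λ (p , _) (q , _) → Empty (p ∩ q)) (π ♭)
    disjoint = Permutationₛ.AllPairs-resp-↭ (setoid (Block n))
      (λ {(p , _)} {(q , _)} e (i , i∈) → e (i , subst (i Subset.∈_) (Subset.∩-comm q p) i∈))
      ((λ { refl r → r }) , (λ { refl r → r }))
      (↭⇒↭ₛ (↭-sym ♭-↭)) (proj₁ (proj₂ π))

    strict : ∀ C D → maxLetter (elements D) ℕ.≤ maxLetter (elements C) → Empty (proj₁ C ∩ proj₁ D) →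
             proj₁ C ≻ proj₁ D
    strict C@(_ , _ , i∈) D@(_ , _ , j∈) D≤C disj
      with maxLetter-attained (∈-elements⁺ C i∈) | maxLetter-attained (∈-elements⁺ D j∈)
    ... | x , x∈ , x≡ | y , y∈ , y≡ = ℕ.≤∧≢⇒< D≤C λ eq → disj (x , Subset.x∈p∩q⁺
      ( ∈-elements⁻ C x∈
      , subst (Subset._∈ proj₁ D) (Fin.toℕ-injective (trans y≡ (trans eq (sym x≡)))) (∈-elements⁻ D y∈)))

  hat-isFlat : IsFlat (K π) (readingWord π)
  hat-isFlat = maximaDecrease⇒isFlat (π ♭) ♭-maximaDecrease

-- Sizes and reading word determine the subsets in `π ♭`. Sorting does not change the set of blocks,
-- and distinct sublists of `blocks n` have distinct sets of subsets.
setPartitions-distinct : ∀ n →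
  AllPairs (λ π ρ → ¬ (K π ≡ K ρ × readingWord π ≡ readingWord ρ)) (setPartitions n)
setPartitions-distinct n = AllPairs.map
  (λ {π ρ} π≢ρ (K≡ , w≡) → π≢ρ λ z →
    mk⇔ (transport π ρ K≡ w≡) (transport ρ π (sym K≡) (sym w≡)))
  (allPairs-select isSetPartition? (sublists-distinct proj₁ (blocks-distinct n)))
  where
  transport : (π ρ : SetPartition n) → K π ≡ K ρ → readingWord π ≡ readingWord ρ →
              ∀ {z} → z ∈ map proj₁ (proj₁ π) → z ∈ map proj₁ (proj₁ ρ)
  transport π ρ K≡ w≡ z∈ = ∈-resp-↭ (↭-map⁺ proj₁ (♭-↭ ρ))
    (subst (_ ∈_) (underlying-injective (π ♭) (ρ ♭) K≡ w≡) (∈-resp-↭ (↭-map⁺ proj₁ (↭-sym (♭-↭ π))) z∈))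

-- A letter shared by blocks at two different places of the list would occur twice in the word.
overlap⇒≡ : (bs : List (Block n)) → Unique (concatMap elements bs) → ∀ {C D i} → C ∈ bs → D ∈ bs →
            i Subset.∈ proj₁ C → i Subset.∈ proj₁ D → C ≡ D
overlap⇒≡ (E ∷ bs) u {C} {D} C∈ D∈ i∈C i∈D with unique-++⁻ (elements E) u | C∈ | D∈
... | _ , _    | here refl | here refl  = refl
... | _ , disj | here refl | there D∈′  =
  contradiction (∈-concatMap⁺′ elements D∈′ (∈-elements⁺ D i∈D)) (disj (∈-elements⁺ E i∈C))
... | _ , disj | there C∈′ | here refl  =
  contradiction (∈-concatMap⁺′ elements C∈′ (∈-elements⁺ C i∈C)) (disj (∈-elements⁺ E i∈D))
... | u′ , _   | there C∈′ | there D∈′  = overlap⇒≡ bs u′ C∈′ D∈′ i∈C i∈D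

module _ {I : Composition} (σ : Perm n) (flat : IsFlat I (proj₁ σ)) where

  private
    bs = proj₁ (isFlat⇒maximaDecrease I (proj₁ σ) flat)
    bs-sizes = proj₁ (proj₂ (isFlat⇒maximaDecrease I (proj₁ σ) flat))
    bs-word = proj₁ (proj₂ (proj₂ (isFlat⇒maximaDecrease I (proj₁ σ) flat)))
    bs≻ = proj₂ (proj₂ (proj₂ (isFlat⇒maximaDecrease I (proj₁ σ) flat)))

    underlies? : Decidable (λ (C : Block n) → proj₁ C ∈ map proj₁ bs)
    underlies? C = _∈?_ (Vec.≡-dec Bool._≟_) (proj₁ C) (map proj₁ bs)

    -- The blocks of bs, as they occur in blocks n: their proofs of nonemptiness may differ.
    cs : List (Block n)
    cs = filter underlies? (blocks n)

    cs⊆bs : ∀ {s} → s ∈ map proj₁ cs → s ∈ map proj₁ bs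
    cs⊆bs s∈ with ∈-map⁻ proj₁ s∈
    ... | _ , C∈ , refl = proj₂ (∈-filter⁻ underlies? {xs = blocks n} C∈)

    bs⊆cs : ∀ {s} → s ∈ map proj₁ bs → s ∈ map proj₁ cs
    bs⊆cs s∈ with ∈-map⁻ proj₁ s∈
    ... | (s , ne) , _ , refl with ∈-select⁺ Subset.nonempty? (∈-subsets s) ne
    ...   | _ , C∈ = ∈-map⁺ proj₁ (∈-filter⁺ underlies? C∈ s∈)

    cs-disjoint : AllPairs (λ (p , _) (q , _) → Empty (p ∩ q)) cs
    cs-disjoint = allPairs-mapWith (All.tabulate λ C∈ → cs⊆bs (∈-map⁺ proj₁ C∈))
      (λ { {C} {D} C∈ D∈ C≢D (i , i∈) → disj C≢D (∈-map⁻ proj₁ C∈) (∈-map⁻ proj₁ D∈)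
                                          (Subset.x∈p∩q⁻ (proj₁ C) (proj₁ D) i∈) })
      (AllPairs.filter⁺ underlies? (blocks-distinct n))
      where
      disj : ∀ {s t : Subset n} {i} → s ≢ t → ∃[ C ] C ∈ bs × s ≡ proj₁ C → ∃[ D ] D ∈ bs × t ≡ proj₁ D →
             ¬ (i Subset.∈ s × i Subset.∈ t)
      disj s≢t (C , C∈ , refl) (D , D∈ , refl) (i∈C , i∈D) =
        s≢t (cong proj₁ (overlap⇒≡ bs (subst Unique (sym bs-word) (proj₂ (proj₂ σ))) C∈ D∈ i∈C i∈D))

    cs-covering : ∀ i → Any (λ (p , _) → i Subset.∈ p) cs
    cs-covering i with ∈-concatMap⁻′ elements bs (subst (i ∈_) (sym bs-word) (permutation-complete (proj₂ σ) i))
    ... | C , C∈ , i∈ with ∈-map⁻ proj₁ (bs⊆cs (∈-map⁺ proj₁ C∈))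
    ...   | D , D∈ , eq = lose D∈ (subst (i Subset.∈_) eq (∈-elements⁻ C i∈))

  setPartition-of-flat : ∃[ π ] π ∈ setPartitions n × K π ≡ I × readingWord π ≡ proj₁ σ
  setPartition-of-flat
    with ∈-select⁺ isSetPartition? (filter-∈-sublists underlies? (blocks n)) (cs-disjoint , cs-covering)
  ... | q , π∈ = π , π∈ , trans (proj₁ eqs) bs-sizes , trans (proj₂ eqs) bs-word
    where
    π = cs , q

    -- Both lists decrease for `≻` and have the same members, so sorting `cs` restores the order in
    -- which the factors of `σ` were cut.
    same : map proj₁ (π ♭) ≡ map proj₁ bs
    same = sorted-unique {R = _≻_} ℕ.<-asym (AllPairs.map⁺ (♭-maximaDecrease π)) (AllPairs.map⁺ bs≻)
      (cs⊆bs ∘ ∈-resp-↭ (↭-map⁺ proj₁ (♭-↭ π)))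
      (∈-resp-↭ (↭-map⁺ proj₁ (↭-sym (♭-↭ π))) ∘ bs⊆cs)

    eqs = underlying-cong (π ♭) bs same

-- Sums over flat permutations

module _ {c ℓ₁ ℓ₂ ℓ₃ ℓ₄} (𝕂 : HeytingField c ℓ₁ ℓ₂) (𝔸 : Alphabet a ℓ₃ ℓ₄) where
  open FreeBell 𝕂 𝔸
  private
    module F = CommutativeRing (HeytingCommutativeRing.commutativeRing (HeytingField.heytingCommutativeRing 𝕂))
  open F using (_≈_; 0#; 1#) renaming (Carrier to Scalar; _+_ to _+ᴷ_; _*_ to _*ᴷ_)

  Term : Set c
  Term = Scalar × Composition × ∃ Perm

  Key : Set
  Key = Composition × ∃[ m ] List (Fin m)

  key : Term → Key
  key (_ , J , σ) = J , word σ

  keys : Tensor → List Key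
  keys = map key

  -- Proofs that a word is a permutation need not be equal, so terms are compared
  -- through their keys.
  record IsFlatSum (n : ℕ) (t : Tensor) : Set (c ⊔ ℓ₁) where
    field
      scalar-one : ∀ {s x} → (s , x) ∈ t → s ≈ 1#
      sound      : ∀ {s J m σ} → (s , J , m , σ) ∈ t → m ≡ n × IsFlat J (proj₁ σ)
      complete   : ∀ J (σ : Perm n) → IsFlat J (proj₁ σ) → ∃[ s ] ∃[ q ] (s , J , n , proj₁ σ , q) ∈ t
      distinct   : AllPairs (λ x y → key x ≢ key y) t

  open IsFlatSum

  keys-⊆ : {t t′ : Tensor} → IsFlatSum n t → IsFlatSum n t′ → ∀ {x} → x ∈ keys t → x ∈ keys t′
  keys-⊆ S S′ x∈ with ∈-map⁻ key x∈
  ... | (s , J , m , σ) , σ∈ , refl with sound S σ∈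
  ...   | refl , flat with complete S′ J σ flat
  ...     | _ , _ , σ∈′ = ∈-map⁺ key σ∈′

  keys-↭ : {t t′ : Tensor} → IsFlatSum n t → IsFlatSum n t′ → keys t ↭ keys t′
  keys-↭ S S′ = ∼bag⇒↭ (unique∧set⇒bag (AllPairs.map⁺ (distinct S)) (AllPairs.map⁺ (distinct S′))
    (mk⇔ (keys-⊆ S S′) (keys-⊆ S′ S)))

  -- Standardization is tested on the word alone, so what a term with scalar `1#` contributes
  -- depends only on its key.
  keyCoefficient : Composition → List (StrictTotalOrder.Carrier (Alphabet.order 𝔸)) → Key → Scalar
  keyCoefficient I w (J , m , σ) = if does (J ≟ᶜ I)
    then (if does (sameInversions? (Alphabet.order 𝔸) (Fin.<-strictTotalOrder m) w σ) then 1# else 0#)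
    else 0#

  sumᴷ : List Scalar → Scalar
  sumᴷ = foldr _+ᴷ_ 0#

  sumᴷ-↭ : ∀ {xs ys} → xs ↭ ys → sumᴷ xs ≈ sumᴷ ys
  sumᴷ-↭ ↭.refl           = F.refl
  sumᴷ-↭ (↭.prep x p)     = F.+-congˡ (sumᴷ-↭ p)
  sumᴷ-↭ (↭.swap x y p)   = F.trans (F.sym (F.+-assoc x y _))
    (F.trans (F.+-cong (F.+-comm x y) (sumᴷ-↭ p)) (F.+-assoc y x _))
  sumᴷ-↭ (↭.trans p q)    = F.trans (sumᴷ-↭ p) (sumᴷ-↭ q)

  -- Terms of other compositions count as `0#` instead of being filtered out, so that a
  -- rearrangement of all keys settles every `I` at once.
  series-coefficient : ∀ I w (t : Tensor) → (∀ {s x} → (s , x) ∈ t → s ≈ 1#) →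
                       series (coefficient I t) w ≈ sumᴷ (map (keyCoefficient I w) (keys t))
  series-coefficient I w [] _ = F.refl
  series-coefficient I w ((s , J , m , σ) ∷ t) ones with J ≟ᶜ I
  ... | yes _ = F.+-cong (F.trans (F.*-congʳ (ones (here refl))) (F.*-identityˡ _))
                         (series-coefficient I w t (ones ∘ there))
  ... | no _  = F.trans (series-coefficient I w t (ones ∘ there)) (F.sym (F.+-identityˡ _))

  isFlatSum⇒≈ᵗ : {t t′ : Tensor} → IsFlatSum n t → IsFlatSum n t′ → t ≈ᵗ t′
  isFlatSum⇒≈ᵗ {t = t} {t′} S S′ I w =
    F.trans (series-coefficient I w t (scalar-one S))
      (F.trans (sumᴷ-↭ (↭-map⁺ (keyCoefficient I w) (keys-↭ S S′)))
        (F.sym (series-coefficient I w t′ (scalar-one S′))))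

  -- One summand of the Bell recursion

  prepend : ∀ k → Term → Tensor
  prepend k (s , J , _ , β) = map (λ γ → 1# *ᴷ s , ((suc k ⁺) ∷ J , γ)) (identity (suc k) ≺ᴳ β)

  YS-≺ : ∀ k t → YS k ≺ t ≡ concatMap (prepend k) t
  YS-≺ k t = ++-identityʳ (concatMap (prepend k) t)

  module _ {t : Tensor} (S : IsFlatSum l t) where

    -- The first part `suc k` of `I` is recorded because it is what separates the summands for
    -- different `k`.
    prepend-sound : ∀ k {s I m γ} → (s , I , m , γ) ∈ YS k ≺ t →
      s ≈ 1# × m ≡ suc k + l × IsFlat I (proj₁ γ) × ∃[ J ] I ≡ (suc k ⁺) ∷ J
    prepend-sound k {γ = γ} γ∈ with ∈-concatMap⁻′ (prepend k) t (subst (_ ∈_) (YS-≺ k t) γ∈)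
    ... | (s , J , _ , β) , β∈ , γ∈′ with ∈-map⁻ (λ γ → 1# *ᴷ s , ((suc k ⁺) ∷ J , γ)) γ∈′
    ...   | _ , γ∈″ , refl with sound S β∈ | ∈-identity-≺ᴳ⁻ k β γ γ∈″
    ...     | refl , flat | refl , inc , dom , std =
      F.trans (F.*-identityˡ s) (scalar-one S β∈) , refl ,
      (ℕ.≤-trans (ℕ.m≤m+n (suc k) l) (ℕ.≤-reflexive (sym (proj₁ (proj₂ γ)))) , inc , dom ,
        Equivalence.from (isFlat-std (Unique.drop⁺ (suc k) (proj₂ (proj₂ γ))) β std J) flat) ,
      J , refl

    prepend-complete : ∀ k {J} (γ : Perm m) → m ≡ suc k + l → IsFlat ((suc k ⁺) ∷ J) (proj₁ γ) →
      ∃[ s ] ∃[ q ] (s , (suc k ⁺) ∷ J , m , proj₁ γ , q) ∈ YS k ≺ t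
    prepend-complete k {J} γ@(w , len , w!) refl (_ , inc , dom , flat)
      with standardization {l = l} (Unique.drop⁺ (suc k) w!)
             (trans (length-drop (suc k) w) (trans (cong (_∸ suc k) len) (ℕ.m+n∸m≡n (suc k) l)))
    ... | β , std with complete S J β (Equivalence.to (isFlat-std (Unique.drop⁺ (suc k) w!) β std J) flat)
    -- The copy of `β` occurring in `t` may carry another proof `q`; `std` only concerns the word.
    ...   | s , q , β∈ with ∈-identity-≺ᴳ⁺ k (proj₁ β , q) γ (refl , inc , dom , std)
    ...     | q′ , γ∈ = _ , q′ , subst (_ ∈_) (sym (YS-≺ k t))
      (∈-concatMap⁺′ (prepend k) β∈ (∈-map⁺ (λ γ → 1# *ᴷ s , ((suc k ⁺) ∷ J , γ)) γ∈))

    prepend-distinct : ∀ k → AllPairs (λ x y → key x ≢ key y) (YS k ≺ t)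
    prepend-distinct k = subst (AllPairs _) (sym (YS-≺ k t))
      (allPairs-concatMap (prepend k) (distinct S) (λ { {s , J , _ , β} _ → within s J β })
        (λ {x} {y} {a} {b} → across {x} {y} {a} {b}))
      where
      within : ∀ s J (β : Perm m) → AllPairs (λ x y → key x ≢ key y) (prepend k (s , J , m , β))
      within s J β = AllPairs.map⁺ (AllPairs.map (λ { γ≢δ refl → γ≢δ refl }) (identity-≺ᴳ-distinct k β))

      -- A common key of `a` and `b` gives equal compositions and equal words after the first
      -- factor; uniqueness of standardization then identifies the keys of `x` and `y`.
      across : ∀ {x y a b} → key x ≢ key y → a ∈ prepend k x → b ∈ prepend k y → key a ≢ key b
      across {s , J , l₁ , β} {s′ , J′ , l₂ , β′} x≢y a∈ b∈ a≡b
        with ∈-map⁻ (λ γ → 1# *ᴷ s , ((suc k ⁺) ∷ J , γ)) a∈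
           | ∈-map⁻ (λ γ → 1# *ᴷ s′ , ((suc k ⁺) ∷ J′ , γ)) b∈
      ... | (_ , γ) , γ∈ , refl | (_ , γ′) , γ∈′ , refl with a≡b
      ... | refl with ∈-identity-≺ᴳ⁻ k β γ γ∈ | ∈-identity-≺ᴳ⁻ k β′ γ′ γ∈′
      ... | eq , _ , _ , std | eq′ , _ , _ , std′ with ℕ.+-cancelˡ-≡ (suc k) l₁ l₂ (trans (sym eq) eq′)
      ... | refl = x≢y (cong (λ w → J , l₁ , w)
        (standardization-unique (Unique.drop⁺ (suc k) (proj₂ (proj₂ γ))) β β′ std std′))

  -- The two sides as sums over flat permutations

  B-suc-summand : ∀ n → Fin (suc n) → Tensor
  B-suc-summand n k = YS (toℕ k) ≺ B (n ∸ toℕ k)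

  bell-isFlatSum : ∀ n → IsFlatSum n (B n)
  bell-isFlatSum = <-rec (λ n → IsFlatSum n (B n)) go
    where
    base : IsFlatSum 0 one
    base = record
      { scalar-one = λ { (here refl) → F.refl }
      ; sound      = λ { (here refl) → refl , refl }
      ; complete   = λ { [] (_ , _) refl → _ , _ , here refl
                       ; (i ∷ I) ([] , _) (i≤0 , _) →
                           contradiction (ℕ.≤-<-trans i≤0 (ℕ.>-nonZero⁻¹ (value i))) (ℕ.<-irrefl refl) }
      ; distinct   = [] ∷ []
      }

    step : ∀ n → ((k : Fin (suc n)) → IsFlatSum (n ∸ toℕ k) (B (n ∸ toℕ k))) → IsFlatSum (suc n) (B (suc n))
    step n ih rewrite B-suc n = record
      { scalar-one = λ x∈ → let k , _ , x∈′ = summand x∈ in proj₁ (prepend-sound (ih k) (toℕ k) x∈′)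
      ; sound      = λ x∈ → let k , _ , x∈′ = summand x∈
                                _ , m≡ , flat , _ = prepend-sound (ih k) (toℕ k) x∈′
                            in trans m≡ (sizes k) , flat
      ; complete   = compl
      ; distinct   = allPairs-concatMap (B-suc-summand n) (Unique.allFin⁺ (suc n))
          (λ {k} _ → prepend-distinct (ih k) (toℕ k))
          λ {k} {k′} k≢k′ a∈ b∈ a≡b → k≢k′ (heads k k′
            (proj₂ (proj₂ (proj₂ (prepend-sound (ih k) (toℕ k) a∈))))
            (proj₂ (proj₂ (proj₂ (prepend-sound (ih k′) (toℕ k′) b∈)))) (cong proj₁ a≡b))
      }
      where
      summand : ∀ {x} → x ∈ concatMap (B-suc-summand n) (allFin (suc n)) →
                ∃[ k ] k ∈ allFin (suc n) × x ∈ B-suc-summand n k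
      summand = ∈-concatMap⁻′ (B-suc-summand n) (allFin (suc n))

      sizes : ∀ k → suc (toℕ k) + (n ∸ toℕ k) ≡ suc n
      sizes k = cong suc (ℕ.m+[n∸m]≡n (ℕ.s≤s⁻¹ (Fin.toℕ<n k)))

      heads : ∀ k k′ {I I′ : Composition} → ∃[ J ] I ≡ (suc (toℕ k) ⁺) ∷ J →
              ∃[ J ] I′ ≡ (suc (toℕ k′) ⁺) ∷ J → I ≡ I′ → k ≡ k′
      heads k k′ (_ , refl) (_ , refl) eq = Fin.toℕ-injective (ℕ.suc-injective (cong value (∷-injectiveˡ eq)))

      compl : ∀ J (σ : Perm (suc n)) → IsFlat J (proj₁ σ) →
              ∃[ s ] ∃[ q ] (s , J , suc n , proj₁ σ , q) ∈ concatMap (B-suc-summand n) (allFin (suc n))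
      compl []                ([] , () , _)
      -- The first part `suc k` is at most the length `suc n`, so `k` indexes a summand of the
      -- recursion.
      compl (suc k ⁺ ∷ J) σ flat@(k<len , _)
        with fromℕ< k<n | Fin.toℕ-fromℕ< k<n
        where k<n = ℕ.≤-trans k<len (ℕ.≤-reflexive (proj₁ (proj₂ σ)))
      ... | k′ | refl with prepend-complete (ih k′) (toℕ k′) σ (sym (sizes k′)) flat
      ...   | s , q , σ∈ = s , q , ∈-concatMap⁺′ (B-suc-summand n) (∈-allFin k′) σ∈

    go : ∀ n → (∀ {m} → m ℕ.< n → IsFlatSum m (B m)) → IsFlatSum n (B n)
    go zero    _   = base
    go (suc n) rec = step n λ k → rec (s≤s (ℕ.m∸n≤m n (toℕ k)))

  setPartitions-isFlatSum : ∀ n → IsFlatSum n (∑ (setPartitions n) (λ π → Y^ K π ⊗ 𝐆 (hat π)))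
  setPartitions-isFlatSum n = subst (IsFlatSum n) (sym ∑≡map) (record
    { scalar-one = λ x∈ → case-term x∈ λ { π refl → F.refl }
    ; sound      = λ x∈ → case-term x∈ λ { π refl → refl , hat-isFlat π }
    ; complete   = λ J σ flat → compl J σ (setPartition-of-flat σ flat)
    ; distinct   = AllPairs.map⁺ (AllPairs.map
        (λ {π} {ρ} π≢ρ eq → π≢ρ (cong proj₁ eq , word-injective (cong proj₂ eq))) (setPartitions-distinct n))
    })
    where
    term : SetPartition n → Term
    term π = 1# , K π , n , hat π

    ∑≡map : ∑ (setPartitions n) (λ π → Y^ K π ⊗ 𝐆 (hat π)) ≡ map term (setPartitions n)
    ∑≡map = trans (sym (concatMap-map [_] term (setPartitions n))) (concatMap-pure (map term (setPartitions n)))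

    case-term : ∀ {x} {P : Set p} → x ∈ map term (setPartitions n) → (∀ π → x ≡ term π → P) → P
    case-term x∈ f = let π , _ , eq = ∈-map⁻ term x∈ in f π eq

    word-injective : {u v : List (Fin n)} → _≡_ {A = ∃[ m ] List (Fin m)} (n , u) (n , v) → u ≡ v
    word-injective refl = refl

    compl : ∀ J (σ : Perm n) → ∃[ π ] π ∈ setPartitions n × K π ≡ J × readingWord π ≡ proj₁ σ →
            ∃[ s ] ∃[ q ] (s , J , n , proj₁ σ , q) ∈ map term (setPartitions n)
    compl J (_ , _) (π , π∈ , refl , refl) = 1# , readingWord-isPermutation π , ∈-map⁺ term π∈

  coefficient-∑ : (J : A → Composition) (σ : A → Perm n) (I : Composition) (xs : List A) →
    coefficient I (∑ xs (λ x → Y^ J x ⊗ 𝐆 (σ x))) ≡ ∑ (filter (λ x → J x ≟ᶜ I) xs) (λ x → 𝐆 (σ x))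
  coefficient-∑ J σ I []       = refl
  coefficient-∑ J σ I (x ∷ xs) with J x ≟ᶜ I
  ... | yes _ = cong (_ ∷_) (coefficient-∑ J σ I xs)
  ... | no _  = coefficient-∑ J σ I xs

proposition3p4 : ∀ {c ℓ₁ ℓ₂ a ℓ₃ ℓ₄} (𝕂 : HeytingField c ℓ₁ ℓ₂) → CharacteristicZero 𝕂 →
  (𝔸 : Alphabet a ℓ₃ ℓ₄) → let open FreeBell 𝕂 𝔸 in
  (n : ℕ) →
    (∀ (I : Composition) → weight I ≡ n →
      coefficient I (B n) ≈ᶠ ∑ (filter (λ π → K π ≟ᶜ I) (setPartitions n)) (λ π → 𝐆 (hat π)))
    × (B n ≈ᵗ ∑ (setPartitions n) (λ π → Y^ K π ⊗ 𝐆 (hat π)))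
proposition3p4 𝕂 _ 𝔸 n =
  -- The claim for a single `I` is the component at `I` of `B≈`, with the filter moved from terms to
  -- set partitions.
  (λ I _ w → subst (λ x → series (coefficient I (B n)) w ≈ series x w)
    (coefficient-∑ 𝕂 𝔸 K hat I (setPartitions n)) (B≈ I w)) ,
  B≈
  where
  open FreeBell 𝕂 𝔸
  open HeytingField 𝕂 using (_≈_)
  B≈ : B n ≈ᵗ ∑ (setPartitions n) (λ π → Y^ K π ⊗ 𝐆 (hat π))
  B≈ = isFlatSum⇒≈ᵗ 𝕂 𝔸 (bell-isFlatSum 𝕂 𝔸 n) (setPartitions-isFlatSum 𝕂 𝔸 n)
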